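{- For every positive integer $q$, with $t=(q^2+5q)/2$ and $n=3^q$, one can construct a $\overline{2}$-separable $t\times n$ Boolean matrix that has a time-optimal analysis algorithm (that is, one whose running time is $O(t)$, with the implied constant independent of $q$).
   Context: A $t\times n$ Boolean matrix $M$ models a non-adaptive group testing regimen: columns correspond to $n$ items, rows to $t$ tests, and test $r$ includes item $i$ iff $M[r,i]=1$. Given an unknown set of defective items, the outcome of a test is positive (1) if the test includes at least one defective item and negative (0) otherwise. $M$ is $\overline{d}$-separable if the Boolean sums (entrywise OR) of up to $d$ columns are all distinct, i.e. different sets of at most $d$ columns have different Boolean sums. An analysis algorithm for a $\overline{d}$-separable matrix takes as input the $t$ test outcomes arising from an unknown set of at most $d$ defective items and outputs that set (each item being output as the list of digits of its index). It is time-optimal if its running time is $O(t)$. -}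

module Defs where

open import Data.Bool using (Bool; true; false; if_then_else_; _∧_; _∨_)
import Data.Bool.Properties as Bool
open import Data.Fin using (Fin; toℕ; finToFun)
open import Data.Fin.Properties using (any?)
open import Data.Fin.Subset using (Subset; ∣_∣) renaming (_∈_ to _∈ˢ_)
open import Data.Fin.Subset.Properties using (_∈?_)
open import Data.List using (List; []; _∷_; _++_; [_]; head; drop; map; concatMap)
import Data.List as List
open import Data.List.Membership.Propositional using (_∈_)
open import Data.List.Relation.Unary.Unique.Propositional using (Unique)
open import Data.Maybe using (Maybe; just; nothing)
open import Data.Nat using (ℕ; zero; suc; pred; _*_; _^_; _≤_; _≡ᵇ_; NonZero)
open import Data.Product using (∃-syntax; _×_)
open import Data.Vec using (Vec; lookup; tabulate; toList)
open import Data.Vec.Functional using (Vector; foldr)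
open import Function.Bundles using (_⇔_)
open import Relation.Binary.PropositionalEquality using (_≡_)
open import Relation.Nullary using (does; _×-dec_)

BooleanMatrix : ℕ → ℕ → Set
BooleanMatrix t n = Vector (Vector Bool n) t

booleanSum : ∀ {t n} → BooleanMatrix t n → Subset n → Vec Bool t
booleanSum M S = tabulate λ r → foldr _∨_ false λ i → lookup S i ∧ M r i

Separable : ∀ {t n} → ℕ → BooleanMatrix t n → Set
Separable {n = n} d M = (S T : Subset n) → ∣ S ∣ ≤ d → ∣ T ∣ ≤ d →
  booleanSum M S ≡ booleanSum M T → S ≡ T

testOutcomes : ∀ {t n} → BooleanMatrix t n → Subset n → Vec Bool t
testOutcomes M D = tabulate λ r →
  does (any? λ i → (i ∈? D) ×-dec (M r i Bool.≟ true))

-- The machine model is the successor RAM: finitely many instructions, unbounded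
-- memory of natural numbers, indirect addressing, unit cost per instruction.
-- There is deliberately no addition. A step increases the largest value in memory
-- by at most one, unless it loads a program constant or an input value, so a run
-- of T steps uses words of only O(log (T + largest constant or input)) bits, and
-- unit cost is a realistic measure: an O(t) bound here is an O(t) bound on a word RAM.

data Instruction : Set where
  const     : (a c : ℕ) → Instruction  -- mem[a] := c
  copy      : (a b : ℕ) → Instruction  -- mem[a] := mem[b]
  inc       : (a : ℕ)   → Instruction  -- mem[a] := mem[a] + 1
  dec       : (a : ℕ)   → Instruction  -- mem[a] := mem[a] ∸ 1
  load      : (a b : ℕ) → Instruction  -- mem[a] := mem[mem[b]]
  store     : (a b : ℕ) → Instruction  -- mem[mem[a]] := mem[b]
  jump      : (l : ℕ)   → Instruction  -- continue at instruction l
  jumpZero  : (a l : ℕ) → Instruction  -- continue at instruction l if mem[a] = 0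
  read      : (a : ℕ)   → Instruction  -- mem[a] := next input (0 if none is left)
  write     : (a : ℕ)   → Instruction  -- append mem[a] to the output

Program : Set
Program = List Instruction

record State : Set where
  constructor state
  field
    pc     : ℕ
    mem    : ℕ → ℕ
    input  : List ℕ
    output : List ℕ

open State

_[_≔_] : (ℕ → ℕ) → ℕ → ℕ → (ℕ → ℕ)
(m [ a ≔ v ]) b = if b ≡ᵇ a then v else m b

execute : Instruction → State → State
execute (const a c)    (state p m is os) = state (suc p) (m [ a ≔ c ]) is os
execute (copy a b)     (state p m is os) = state (suc p) (m [ a ≔ m b ]) is os
execute (inc a)        (state p m is os) = state (suc p) (m [ a ≔ suc (m a) ]) is os
execute (dec a)        (state p m is os) = state (suc p) (m [ a ≔ pred (m a) ]) is os
execute (load a b)     (state p m is os) = state (suc p) (m [ a ≔ m (m b) ]) is os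
execute (store a b)    (state p m is os) = state (suc p) (m [ m a ≔ m b ]) is os
execute (jump l)       (state p m is os) = state l m is os
execute (jumpZero a l) (state p m is os) = state (if m a ≡ᵇ 0 then l else suc p) m is os
execute (read a)       (state p m [] os) = state (suc p) (m [ a ≔ 0 ]) [] os
execute (read a)       (state p m (i ∷ is) os) = state (suc p) (m [ a ≔ i ]) is os
execute (write a)      (state p m is os) = state (suc p) m is (os ++ [ m a ])

fetch : Program → ℕ → Maybe Instruction
fetch P p = head (drop p P)

-- P ⊢ s ⇓ os after k : started in s, the program P halts (its program counter
-- leaves the program) after executing exactly k instructions, with output os.
data _⊢_⇓_after_ (P : Program) : State → List ℕ → ℕ → Set where
  halt : ∀ {s} → fetch P (pc s) ≡ nothing → P ⊢ s ⇓ output s after 0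
  step : ∀ {s i os k} → fetch P (pc s) ≡ just i →
         P ⊢ execute i s ⇓ os after k → P ⊢ s ⇓ os after suc k

start : List ℕ → State
start is = state 0 (λ _ → 0) is []

bit : Bool → ℕ
bit b = if b then 1 else 0

-- The array of test outcomes, preceded by its length.
encodeOutcomes : ∀ {t} → Vec Bool t → List ℕ
encodeOutcomes {t} v = t ∷ map bit (toList v)

-- The q digits of an index in base b, most significant first.
digits : (b q : ℕ) → Fin (b ^ q) → List ℕ
digits b q i = List.tabulate λ j → toℕ (finToFun {b} {q} i j)

_Lists_ : ∀ {n} → List (Fin n) → Subset n → Set
L Lists D = Unique L × (∀ i → i ∈ L ⇔ i ∈ˢ D)

-- P outputs D when it writes the digits of the elements of D, one element after
-- the other, in any order of the elements but without repetition. As every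
-- element takes q ≥ 1 digits, this determines D.
OutputEncodes : (b q : ℕ) → List ℕ → Subset (b ^ q) → Set
OutputEncodes b q os D = ∃[ L ] (L Lists D × os ≡ concatMap (digits b q) L)

-- Running times O(t) make sense only for a family of matrices. One program and one
-- constant serve all of them: if the program could vary with q, an O(t)-step
-- decision tree for each matrix could be hard-wired into it.
HasTimeOptimalAnalysis :
  (d b : ℕ) (t : ℕ → ℕ) →
  ((q : ℕ) → .{{NonZero q}} → BooleanMatrix (t q) (b ^ q)) → Set
HasTimeOptimalAnalysis d b t M =
  ∃[ P ] ∃[ c ] ∀ (q : ℕ) .{{_ : NonZero q}} (D : Subset (b ^ q)) → ∣ D ∣ ≤ d →
    ∃[ os ] ∃[ k ]
      ( P ⊢ start (encodeOutcomes (testOutcomes (M q) D)) ⇓ os after k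
      × k ≤ c * t q
      × OutputEncodes b q os D )

{-# OPTIONS --safe #-}
module Submission where

-- For every position p there are three tests "digit p is v" and, for every j < p, a test
-- "digits j and p agree". The first three reveal the set of digits that at most two defective
-- items have at p. Let a be the first position at which this set has two elements. At a later
-- ambiguous position p, two 2-element sets of digits out of three always meet, so exactly one of
-- the two ways of matching the digits at p with those at a contains an agreement, and the
-- outcome of the agreement test of a and p tells which one occurs. With the tests of position p
-- in one block, this is a single pass over the outcomes in which the digits of the first item
-- are output at once and those of the second are kept until the end. Three negative digit
-- tests occur only when there is no defective item or, as reading past the end of the input
-- gives zeros, after the last block. Separability is a consequence of analysability, since runs
-- are deterministic and the output determines the set.

open import Defs
open import Data.Bool using (Bool; true; false; if_then_else_; _∧_; _∨_; T)
import Data.Bool.Properties as Bool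
open import Data.Fin using (Fin; zero; suc; toℕ)
import Data.Fin as Fin
open import Data.Fin.Patterns using (0F; 1F; 2F)
import Data.Fin.Properties as Fin
open import Data.Fin.Subset using (Subset; Empty; ∣_∣) renaming (_∈_ to _∈ˢ_)
open import Data.Fin.Subset.Properties
  using (_∈?_; x∈p∧x≢y⇒x∈p-y; x∈p⇒∣p-x∣<∣p∣; ⊆-antisym)
open import Data.List using (List; []; _∷_; _++_; [_]; applyUpTo; concatMap; drop; length; map)
import Data.List as List
open import Data.List.Relation.Unary.All using ([]; _∷_)
open import Data.List.Relation.Unary.AllPairs using ([]; _∷_)
open import Data.List.Relation.Unary.Any using (here; there)
open import Data.List.Properties
  using (++-assoc; ++-identityʳ; drop-[]; length-++; length-applyUpTo; length-tabulate; map-++;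
         map-applyUpTo; map-cong; map-∘; ∷-injectiveˡ; ∷-injectiveʳ)
open import Data.Maybe using (just; nothing)
open import Data.Nat
  using (ℕ; zero; suc; pred; _+_; _*_; _^_; _/_; _≤_; _<_; _≡ᵇ_; z≤n; s≤s; NonZero;
         >-nonZero⁻¹)
open import Data.Nat.DivMod using (m*n/n≡m)
open import Data.Nat.Properties hiding (_≟_)
open import Data.Nat.Tactic.RingSolver using (solve-∀)
open import Data.Product using (Σ; ∃-syntax; _×_; _,_)
open import Data.Sum using (_⊎_; inj₁; inj₂; [_,_]′)
import Data.Sum as Sum
open import Data.Vec using (Vec; []; _∷_; lookup; tabulate; toList)
open import Data.Vec.Functional using (foldr)
open import Data.Vec.Properties using (tabulate-cong)
open import Function using (_∘_)
open import Function.Bundles using (Equivalence; mk⇔)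
open import Relation.Binary using (tri<; tri≈; tri>)
open import Relation.Binary.PropositionalEquality
  using (_≡_; _≢_; _≗_; refl; sym; trans; cong; cong₂; subst)
open import Relation.Nullary
  using (Dec; does; yes; no; contradiction; ¬?; _×-dec_; decidable-stable)
open import Relation.Nullary.Decidable using (dec-true; dec-false)

private
  variable
    P : Program
    s s′ : State
    os : List ℕ
    j k : ℕ

-- Timed execution

infix 4 _⊢_⇓_within_ _≈_

_⊢_⇓_within_ : Program → State → List ℕ → ℕ → Set
P ⊢ s ⇓ os within k = ∃[ j ] (j ≤ k × P ⊢ s ⇓ os after j)

within-mono : j ≤ k → P ⊢ s ⇓ os within j → P ⊢ s ⇓ os within k
within-mono j≤k (i , i≤j , d) = i , ≤-trans i≤j j≤k , d

-- Without function extensionality, memories can only be compared pointwise.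
data _≈_ : State → State → Set where
  mem≗ : ∀ {p m m′ is os} → m ≗ m′ → state p m is os ≈ state p m′ is os

≔-cong : ∀ {m m′ a a′ v v′} → m ≗ m′ → a ≡ a′ → v ≡ v′ → (m [ a ≔ v ]) ≗ (m′ [ a′ ≔ v′ ])
≔-cong {a = a} m≗m′ refl v≡v′ b with b ≡ᵇ a
... | true  = v≡v′
... | false = m≗m′ b

execute-cong : ∀ i → s ≈ s′ → execute i s ≈ execute i s′
execute-cong (const a c)    (mem≗ e) = mem≗ (≔-cong e refl refl)
execute-cong (copy a b)     (mem≗ e) = mem≗ (≔-cong e refl (e b))
execute-cong (inc a)        (mem≗ e) = mem≗ (≔-cong e refl (cong suc (e a)))
execute-cong (dec a)        (mem≗ e) = mem≗ (≔-cong e refl (cong pred (e a)))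
execute-cong (load a b)     (mem≗ {m′ = m′} e) =
  mem≗ (≔-cong e refl (trans (e _) (cong m′ (e b))))
execute-cong (store a b)    (mem≗ e) = mem≗ (≔-cong e (e a) (e b))
execute-cong (jump l)       (mem≗ e) = mem≗ e
execute-cong (jumpZero a l) (mem≗ e) rewrite e a = mem≗ e
execute-cong (read a) (mem≗ {is = []} e)    = mem≗ (≔-cong e refl refl)
execute-cong (read a) (mem≗ {is = _ ∷ _} e) = mem≗ (≔-cong e refl refl)
execute-cong (write a)      (mem≗ e) rewrite e a = mem≗ e

⇓-resp-≈ : s ≈ s′ → P ⊢ s ⇓ os after k → P ⊢ s′ ⇓ os after k
⇓-resp-≈ (mem≗ _)   (halt f)         = halt f
⇓-resp-≈ q@(mem≗ _) (step {i = i} f d) = step f (⇓-resp-≈ (execute-cong i q) d)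

-- Runs until the program counter comes (back) to l, for at most k steps.
runTo : ℕ → ℕ → Program → State → State
runTo l zero    P s = s
runTo l (suc k) P s with fetch P (State.pc s)
... | nothing = s
... | just i  = if State.pc (execute i s) ≡ᵇ l then execute i s else runTo l k P (execute i s)

-- Lets loop-free code be executed on symbolic states by normalisation, so that only loops need
-- induction. Surplus fuel `k` merely weakens the time bound, which is why round numbers such as 40
-- serve below.
runTo-sound : ∀ l k P s → P ⊢ runTo l k P s ⇓ os within j → P ⊢ s ⇓ os within (k + j)
runTo-sound l zero    P s d = d
runTo-sound l (suc k) P s d with fetch P (State.pc s) in eq
... | nothing = within-mono (m≤n+m _ (suc k)) d
... | just i with State.pc (execute i s) ≡ᵇ l
...   | false with runTo-sound l k P (execute i s) d
...     | i′ , i′≤ , d′ = suc i′ , s≤s i′≤ , step eq d′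
runTo-sound l (suc k) P s (i′ , i′≤j , d) | just i | true =
  suc i′ , s≤s (≤-trans i′≤j (m≤n+m _ k)) , step eq d

cells : ∀ {n} → Vec ℕ n → (ℕ → ℕ) → ℕ → ℕ
cells []       f a       = f a
cells (v ∷ vs) f zero    = v
cells (v ∷ vs) f (suc a) = cells vs f a

-- Rewrites a memory as eight registers followed by an array, which makes the result of a
-- symbolic run convertible to the expected state and keeps it from growing with every step.
tidy : State → State
tidy s = state pc (cells (mem 0 ∷ mem 1 ∷ mem 2 ∷ mem 3 ∷ mem 4 ∷ mem 5 ∷ mem 6 ∷ mem 7 ∷ [])
                         (λ a → mem (8 + a))) input output
  where open State s

tidy-≈ : ∀ s → tidy s ≈ s
tidy-≈ (state p m is os) = mem≗ λ where
  0 → refl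
  1 → refl
  2 → refl
  3 → refl
  4 → refl
  5 → refl
  6 → refl
  7 → refl
  (suc (suc (suc (suc (suc (suc (suc (suc a)))))))) → refl

runTo-tidy : ∀ l k {s s′} → tidy (runTo l k P s) ≡ s′ →
  P ⊢ s′ ⇓ os within j → P ⊢ s ⇓ os within (k + j)
runTo-tidy {P = P} l k {s} refl (i , i≤j , d) =
  runTo-sound l k P s (i , i≤j , ⇓-resp-≈ (tidy-≈ _) d)

within-step : ∀ {i} → fetch P (State.pc s) ≡ just i → tidy (execute i s) ≡ s′ →
  P ⊢ s′ ⇓ os within k → P ⊢ s ⇓ os within (1 + k)
within-step f refl (i , i≤k , d) = suc i , s≤s i≤k , step f (⇓-resp-≈ (tidy-≈ _) d)

-- The analysis program

-- before and after count the positions on either side of the first ambiguous position a; is12 and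
-- is01 record whether the digits at a are {1,2} or {0,1}. A digit v of the second item is stored
-- as v + 1, so that 0 marks the end of the array, and next is the address of the first free cell.
next before after count is12 is01 agrees tmp array : ℕ
next   = 0
before = 1
after  = 2
count  = 3
is12   = 4
is01   = 5
agrees = 6
tmp    = 7
array  = 8

-- Position-dependent code: the argument is the address at which it is placed.
Code : Set
Code = ℕ → Program

-- No jump leads past `c₀` after `c₁`, because every branch used here ends by jumping away.
ifZero : ℕ → Code → Code → Code
ifZero a c₀ c₁ l = jumpZero a l₀ ∷ p₁ ++ c₀ l₀
  where
  p₁ = c₁ (1 + l)
  l₀ = 1 + l + length p₁

ifPositive : Code → Code → Code
ifPositive c₁ c₀ l = read tmp ∷ ifZero tmp c₀ c₁ (1 + l)

infixr 5 _⨾_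

_⨾_ : Instruction → Code → Code
(i ⨾ c) l = i ∷ c (1 + l)

emit : (v w l : ℕ) → Code
emit v w l _ =
  const tmp v ∷ write tmp ∷ const tmp (suc w) ∷ store next tmp ∷ inc next ∷ jump l ∷ []

byDigits : (c₀₁ c₀₂ c₀ c₁₂ c₁ c₂ none : Code) → Code
-- Positive tests for 0 and 1 settle the set, but the third outcome of the block still has to be
-- consumed.
byDigits c₀₁ c₀₂ c₀ c₁₂ c₁ c₂ none =
  ifPositive (ifPositive (read tmp ⨾ c₀₁) (ifPositive c₀₂ c₀))
             (ifPositive (ifPositive c₁₂ c₁) (ifPositive c₂ none))

skip : ℕ → Code
skip r l =
  copy count r ∷ jumpZero count (5 + l) ∷ read tmp ∷ dec count ∷ jump (1 + l) ∷ []

-- Any address outside the program will do.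
exit : ℕ
exit = 1000

writeArray : Code
writeArray l =
  const count array ∷ load tmp count ∷ jumpZero tmp exit ∷ dec tmp ∷ write tmp ∷ inc count ∷
  jump (1 + l) ∷ []

-- Let v < w be the digits at the current position and v′ < w′ those at a. The agreement test is
-- positive when v goes with v′, unless {v , w} and {v′ , w′} are {0 , 1} and {1 , 2} in some
-- order: then only the digit 1 can agree, and it is the larger of one pair and the smaller of
-- the other.
ambiguous : (done : ℕ) → Code
ambiguous done l =
  skip before l ++ read agrees ∷ skip after (6 + l) ++ inc after ∷
  byDigits (ifZero is12 (oriented 0 1) (oriented 1 0)) (oriented 0 2) (emit 0 0 l)
           (ifZero is01 (oriented 1 2) (oriented 2 1)) (emit 1 1 l)
           (emit 2 2 l) (λ _ → jump done ∷ []) (12 + l)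
  where
  oriented : ℕ → ℕ → Code
  oriented v w = ifZero agrees (emit w v l) (emit v w l)

unambiguous : (found : ℕ) → Code
unambiguous found l =
  skip before l ++
  byDigits (inc is01 ⨾ emit 0 1 found) (emit 0 2 found) (inc before ⨾ emit 0 0 l)
           (inc is12 ⨾ emit 1 2 found) (inc before ⨾ emit 1 1 l)
           (inc before ⨾ emit 2 2 l) (λ _ → jump exit ∷ []) (5 + l)

done found top : ℕ
done  = 3
found = done + length (writeArray done)
top   = found + length (ambiguous done found)

program : Program
program =
  read tmp ∷ const next array ∷ jump top ∷
  writeArray done ++ ambiguous done found ++ unambiguous found top

-- Symbolic runs through the digit tests of one block

all₃ : ∀ {A : Fin 3 → Set} → A 0F → A 1F → A 2F → ∀ i → A i
all₃ a₀ a₁ a₂ 0F = a₀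
all₃ a₀ a₁ a₂ 1F = a₁
all₃ a₀ a₁ a₂ 2F = a₂

-- The matching of digits, checked for three pairs at the first ambiguous position and nine at the
-- current one. As `u` is below `u′`, the former pair is {1,2} exactly if `u` is 1 and {0,1} exactly
-- if `u′` is 1, whence the flags.
ambiguous-tail : ∀ {p a b z arr rest os} (u u′ : Fin 3) → u Fin.< u′ → (v v′ : Fin 3) →
  tidy (runTo found 40 program
    (state (11 + found)
      (cells (8 + p ∷ a ∷ b ∷ 0 ∷ bit (does (u Fin.≟ 1F)) ∷ bit (does (u′ Fin.≟ 1F)) ∷
              bit (does (u Fin.≟ v) ∨ does (u′ Fin.≟ v′)) ∷ z ∷ []) arr)
      (bit (does (v Fin.≟ 0F) ∨ does (v′ Fin.≟ 0F)) ∷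
       bit (does (v Fin.≟ 1F) ∨ does (v′ Fin.≟ 1F)) ∷
       bit (does (v Fin.≟ 2F) ∨ does (v′ Fin.≟ 2F)) ∷ rest) os))
  ≡ state found
      (cells (8 + suc p ∷ a ∷ suc b ∷ 0 ∷ bit (does (u Fin.≟ 1F)) ∷ bit (does (u′ Fin.≟ 1F)) ∷
              bit (does (u Fin.≟ v) ∨ does (u′ Fin.≟ v′)) ∷ suc (toℕ v′) ∷ [])
             (arr [ p ≔ suc (toℕ v′) ]))
      rest (os ++ [ toℕ v ])
ambiguous-tail 0F 1F _ = all₃ (all₃ refl refl refl) (all₃ refl refl refl) (all₃ refl refl refl)
ambiguous-tail 0F 2F _ = all₃ (all₃ refl refl refl) (all₃ refl refl refl) (all₃ refl refl refl)
ambiguous-tail 1F 1F (s≤s ())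
ambiguous-tail 1F 2F _ = all₃ (all₃ refl refl refl) (all₃ refl refl refl) (all₃ refl refl refl)
ambiguous-tail 2F 1F (s≤s ())
ambiguous-tail 2F 2F (s≤s (s≤s ()))

unambiguous-tail-≡ : ∀ {p z e arr rest os os′} (v v′ : Fin 3) → v ≡ v′ →
  program ⊢ state top
    (cells (8 + suc p ∷ suc p ∷ 0 ∷ 0 ∷ 0 ∷ 0 ∷ e ∷ suc (toℕ v′) ∷ [])
           (arr [ p ≔ suc (toℕ v′) ]))
    rest (os ++ [ toℕ v ]) ⇓ os′ within k →
  program ⊢ state (5 + top)
    (cells (8 + p ∷ p ∷ 0 ∷ 0 ∷ 0 ∷ 0 ∷ e ∷ z ∷ []) arr)
    (bit (does (v Fin.≟ 0F) ∨ does (v′ Fin.≟ 0F)) ∷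
     bit (does (v Fin.≟ 1F) ∨ does (v′ Fin.≟ 1F)) ∷
     bit (does (v Fin.≟ 2F) ∨ does (v′ Fin.≟ 2F)) ∷ rest) os ⇓ os′ within (40 + k)
unambiguous-tail-≡ 0F .0F refl = runTo-tidy top 40 refl
unambiguous-tail-≡ 1F .1F refl = runTo-tidy top 40 refl
unambiguous-tail-≡ 2F .2F refl = runTo-tidy top 40 refl

-- At the first ambiguous position there is no earlier pair to match with, so the smaller digit goes
-- to the item that is output first.
unambiguous-tail-< : ∀ {p z e arr rest os os′} (v v′ : Fin 3) → v Fin.< v′ →
  program ⊢ state found
    (cells (8 + suc p ∷ p ∷ 0 ∷ 0 ∷ bit (does (v Fin.≟ 1F)) ∷ bit (does (v′ Fin.≟ 1F)) ∷
            e ∷ suc (toℕ v′) ∷ []) (arr [ p ≔ suc (toℕ v′) ]))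
    rest (os ++ [ toℕ v ]) ⇓ os′ within k →
  program ⊢ state (5 + top)
    (cells (8 + p ∷ p ∷ 0 ∷ 0 ∷ 0 ∷ 0 ∷ e ∷ z ∷ []) arr)
    (bit (does (v Fin.≟ 0F) ∨ does (v′ Fin.≟ 0F)) ∷
     bit (does (v Fin.≟ 1F) ∨ does (v′ Fin.≟ 1F)) ∷
     bit (does (v Fin.≟ 2F) ∨ does (v′ Fin.≟ 2F)) ∷ rest) os ⇓ os′ within (40 + k)
unambiguous-tail-< 0F 1F _ = runTo-tidy found 40 refl
unambiguous-tail-< 0F 2F _ = runTo-tidy found 40 refl
unambiguous-tail-< 1F 1F (s≤s ())
unambiguous-tail-< 1F 2F _ = runTo-tidy found 40 refl
unambiguous-tail-< 2F 1F (s≤s ())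
unambiguous-tail-< 2F 2F (s≤s (s≤s ()))

-- The skipping loops

record SkipAt (r l : ℕ) : Set where
  constructor skipAt
  field
    fetch₀ : fetch program l       ≡ just (copy count r)
    fetch₁ : fetch program (1 + l) ≡ just (jumpZero count (5 + l))
    fetch₂ : fetch program (2 + l) ≡ just (read tmp)
    fetch₃ : fetch program (3 + l) ≡ just (dec count)
    fetch₄ : fetch program (4 + l) ≡ just (jump (1 + l))

module _ {nx bf af f₁ f₂ ag : ℕ} {arr : ℕ → ℕ} {os : List ℕ} where

  private
    at : (l n z : ℕ) → List ℕ → State
    at l n z is = state l (cells (nx ∷ bf ∷ af ∷ n ∷ f₁ ∷ f₂ ∷ ag ∷ z ∷ []) arr) is os

  -- Four instructions per outcome and one final `jumpZero`. The continuation must work for every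
  -- `z′`, as `tmp` keeps a leftover value. Past the end of the input the loop reads zeros and
  -- `drop` stays empty, as happens after the last block.
  skipLoop-run : ∀ {r l} → SkipAt r l → ∀ n {is is′ z} → drop n is ≡ is′ → {os′ : List ℕ} →
    (∀ z′ → program ⊢ at (5 + l) 0 z′ is′ ⇓ os′ within k) →
    program ⊢ at (1 + l) n z is ⇓ os′ within (n * 4 + (1 + k))
  skipLoop-run {l = l} s zero {is} {z = z} refl d =
    within-step {s′ = at (5 + l) 0 z is} fetch₁ refl (d z)
    where open SkipAt s
  skipLoop-run {l = l} s (suc n) {[]} {z = z} refl d =
    within-step {s′ = at (2 + l) (suc n) z []} fetch₁ refl
      (within-step {s′ = at (3 + l) (suc n) 0 []} fetch₂ refl
        (within-step {s′ = at (4 + l) n 0 []} fetch₃ refl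
          (within-step {s′ = at (1 + l) n 0 []} fetch₄ refl
            (skipLoop-run s n (drop-[] n) d))))
    where open SkipAt s
  skipLoop-run {l = l} s (suc n) {i ∷ is} {z = z} refl d =
    within-step {s′ = at (2 + l) (suc n) z (i ∷ is)} fetch₁ refl
      (within-step {s′ = at (3 + l) (suc n) i is} fetch₂ refl
        (within-step {s′ = at (4 + l) n i is} fetch₃ refl
          (within-step {s′ = at (1 + l) n i is} fetch₄ refl
            (skipLoop-run s n refl d))))
    where open SkipAt s

  skip-run : ∀ {r l} → SkipAt r l → ∀ n {is is′ c z} →
    cells (nx ∷ bf ∷ af ∷ c ∷ f₁ ∷ f₂ ∷ ag ∷ z ∷ []) arr r ≡ n → drop n is ≡ is′ → {os′ : List ℕ} →
    (∀ z′ → program ⊢ at (5 + l) 0 z′ is′ ⇓ os′ within k) →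
    program ⊢ at l c z is ⇓ os′ within (1 + (n * 4 + (1 + k)))
  skip-run {l = l} s n {is} {z = z} refl eq d =
    within-step {s′ = at (1 + l) n z is} (SkipAt.fetch₀ s) refl (skipLoop-run s n eq d)

skip₁ : SkipAt before top
skip₁ = skipAt refl refl refl refl refl

skip₂ : SkipAt before found
skip₂ = skipAt refl refl refl refl refl

skip₃ : SkipAt after (6 + found)
skip₃ = skipAt refl refl refl refl refl

-- The stored digits of the second item and their output

column : (ℕ → Fin 3) → ℕ → ℕ → ℕ
column y zero    = λ _ → 0
-- This is literally the update made by the `store` at position `p`, so the array after a block is
-- again a `column` by conversion.
column y (suc p) = column y p [ p ≔ suc (toℕ (y p)) ]

column-< : ∀ y {j p} → j < p → column y p j ≡ suc (toℕ (y j))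
column-< y {j} {suc p} (s≤s j≤p) with j ≡ᵇ p in eq
... | true rewrite ≡ᵇ⇒≡ j p (subst T (sym eq) _) = refl
... | false = column-< y (≤∧≢⇒< j≤p λ { refl → subst T eq (≡⇒≡ᵇ j j refl) })

column-≥ : ∀ y {j p} → p ≤ j → column y p j ≡ 0
column-≥ y {j} {zero}  p≤j = refl
column-≥ y {j} {suc p} p<j with j ≡ᵇ p in eq
... | true  = contradiction (sym (≡ᵇ⇒≡ j p (subst T (sym eq) _))) (<⇒≢ p<j)
... | false = column-≥ y (<⇒≤ p<j)

from : (ℕ → Fin 3) → ℕ → ℕ → List ℕ
from x p zero    = []
from x p (suc m) = toℕ (x p) ∷ from x (suc p) m

exited : ∀ {m is out} → program ⊢ state exit m is out ⇓ out within 0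
exited = 0 , z≤n , halt refl

-- Induction on the number `m` of digits left: six instructions for each, and two to find the 0
-- behind the last.
writeArray-run : ∀ y q j m → q ≡ j + m → ∀ {nx bf af f₁ f₂ ag z is out} →
  program ⊢ state (1 + done)
                  (cells (nx ∷ bf ∷ af ∷ 8 + j ∷ f₁ ∷ f₂ ∷ ag ∷ z ∷ []) (column y q)) is out
    ⇓ out ++ from y j m within (m * 6 + 2)
writeArray-run y q j zero q≡j {out = out} rewrite ++-identityʳ out =
  within-step refl
    -- The cell read depends on the variable `q`, so its value does not compute and is supplied by
    -- `column-≥`.
    (cong (λ w → state _ (cells (_ ∷ _ ∷ _ ∷ _ ∷ _ ∷ _ ∷ _ ∷ w ∷ []) _) _ _)
          (column-≥ y (≤-reflexive (trans q≡j (+-identityʳ j)))))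
    (within-step refl refl exited)
writeArray-run y q j (suc m) q≡j+1+m {out = out}
  rewrite sym (++-assoc out [ toℕ (y j) ] (from y (suc j) m)) =
  within-step refl
    (cong (λ w → state _ (cells (_ ∷ _ ∷ _ ∷ _ ∷ _ ∷ _ ∷ _ ∷ w ∷ []) _) _ _)
          (column-< y (subst (j <_) (sym q≡j+1+m) (m<m+n j (s≤s z≤n)))))
    (runTo-tidy (1 + done) 5 refl
      (writeArray-run y q (suc j) m (trans q≡j+1+m (+-suc j m))))

-- The tests, their order and their outcomes

Test : Set
Test = (ℕ → Fin 3) → Bool

agree : ℕ → ℕ → Test
agree j p x = does (x j Fin.≟ x p)

hasDigit : ℕ → Fin 3 → Test
hasDigit p v x = does (x p Fin.≟ v)

blocks : (p m : ℕ) → List Test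
blocks p zero    = []
blocks p (suc m) =
  applyUpTo (λ j → agree j p) p ++
  hasDigit p 0F ∷ hasDigit p 1F ∷ hasDigit p 2F ∷ blocks (suc p) m

-- A single defective item is the case where `x` and `y` coincide.
outcome : (x y : ℕ → Fin 3) → Test → ℕ
outcome x y f = bit (f x ∨ f y)

outcomes : (x y : ℕ → Fin 3) → (p m : ℕ) → List ℕ
outcomes x y p m = map (outcome x y) (blocks p m)

drop-applyUpTo : ∀ {A : Set} (f : ℕ → A) m n {xs} →
  drop m (applyUpTo f (m + suc n) ++ xs) ≡ f m ∷ applyUpTo (λ i → f (suc m + i)) n ++ xs
drop-applyUpTo f zero    n = refl
drop-applyUpTo f (suc m) n = drop-applyUpTo (f ∘ suc) m n

drop-applyUpTo-all : ∀ {A : Set} (f : ℕ → A) n {xs} → drop n (applyUpTo f n ++ xs) ≡ xs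
drop-applyUpTo-all f zero    = refl
drop-applyUpTo-all f (suc n) = drop-applyUpTo-all (f ∘ suc) n

outcomes-suc : ∀ x y p m → outcomes x y p (suc m) ≡
  applyUpTo (λ j → outcome x y (agree j p)) p ++
  outcome x y (hasDigit p 0F) ∷ outcome x y (hasDigit p 1F) ∷ outcome x y (hasDigit p 2F) ∷
  outcomes x y (suc p) m
outcomes-suc x y p m =
  trans (map-++ (outcome x y) (applyUpTo (λ j → agree j p) p) _)
        (cong (_++ map (outcome x y)
                         (hasDigit p 0F ∷ hasDigit p 1F ∷ hasDigit p 2F ∷ blocks (suc p) m))
              (map-applyUpTo (λ j → agree j p) (outcome x y) p))

drop-agree : ∀ x y p m → drop p (outcomes x y p (suc m)) ≡
  outcome x y (hasDigit p 0F) ∷ outcome x y (hasDigit p 1F) ∷ outcome x y (hasDigit p 2F) ∷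
  outcomes x y (suc p) m
drop-agree x y p m =
  trans (cong (drop p) (outcomes-suc x y p m))
        (drop-applyUpTo-all (λ j → outcome x y (agree j p)) p)

drop-agree-until : ∀ x y a b {p} m → p ≡ a + suc b → drop a (outcomes x y p (suc m)) ≡
  outcome x y (agree a p) ∷ applyUpTo (λ i → outcome x y (agree (suc a + i) p)) b ++
  outcome x y (hasDigit p 0F) ∷ outcome x y (hasDigit p 1F) ∷ outcome x y (hasDigit p 2F) ∷
  outcomes x y (suc p) m
drop-agree-until x y a b {p} m refl =
  trans (cong (drop a) (outcomes-suc x y p m))
        (drop-applyUpTo (λ j → outcome x y (agree j p)) a b)

-- Correctness and running time of the pass over the blocks

-- An upper bound for the time from the start of block p when m blocks are left.
cost : (p m : ℕ) → ℕ
cost p zero    = p * 10 + 60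
cost p (suc m) = p * 4 + 50 + cost (suc p) m

≤-slack : ∀ {m n} o → m + o ≡ n → m ≤ n
≤-slack o refl = m≤m+n _ o

-- Skipping takes 4 steps per outcome and writing the array 6 per digit, hence the 10 per position.
ambiguous-end-cost : ∀ a b →
  1 + (a * 4 + (1 + (1 + (1 + (b * 4 + (1 + (10 + ((a + suc b) * 6 + 2)))))))) + 47
    ≡ (a + suc b) * 10 + 60
ambiguous-end-cost = solve-∀

ambiguous-cost : ∀ a b c →
  1 + (a * 4 + (1 + (1 + (1 + (b * 4 + (1 + (40 + c))))))) + 9 ≡ (a + suc b) * 4 + 50 + c
ambiguous-cost = solve-∀

-- Induction on the number `m` of blocks left. The equation for `p` splits the agreement tests of
-- block `p` into `a` to be skipped, the one with position `a`, and `b` more to be skipped.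
ambiguous-run : ∀ x y a → x a Fin.< y a → ∀ m b p q → p ≡ a + suc b → q ≡ p + m → ∀ {e z os} →
  program ⊢ state found (cells (8 + p ∷ a ∷ b ∷ 0 ∷ bit (does (x a Fin.≟ 1F)) ∷
                                bit (does (y a Fin.≟ 1F)) ∷ e ∷ z ∷ []) (column y p))
                  (outcomes x y p m) os
    ⇓ os ++ (from x p m ++ from y 0 q) within cost p m
ambiguous-run x y a x<y zero b p q refl refl rewrite +-identityʳ p =
  -- No input is left: all reads give 0, which looks like three negative digit tests, and the array
  -- is written.
  within-mono (≤-slack 47 (ambiguous-end-cost a b))
    (skip-run skip₂ a refl (drop-[] a) λ z →
      within-step
        {s′ = state (6 + found)
                (cells (8 + p ∷ a ∷ b ∷ 0 ∷ bit (does (x a Fin.≟ 1F)) ∷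
                        bit (does (y a Fin.≟ 1F)) ∷ 0 ∷ z ∷ []) (column y p)) [] _}
        refl refl
        (skip-run skip₃ b refl (drop-[] b) λ _ →
          runTo-tidy (1 + done) 10 refl (writeArray-run y _ 0 _ refl)))
ambiguous-run x y a x<y (suc m) b p q p≡@refl q≡ {os = os}
  rewrite sym (++-assoc os [ toℕ (x p) ] (from x (suc p) m ++ from y 0 q)) =
  within-mono (≤-slack 9 (ambiguous-cost a b (cost (suc p) m)))
    (skip-run skip₂ a refl (drop-agree-until x y a b m p≡) λ z →
      within-step
        {s′ = state (6 + found)
                (cells (8 + p ∷ a ∷ b ∷ 0 ∷ bit (does (x a Fin.≟ 1F)) ∷
                        bit (does (y a Fin.≟ 1F)) ∷ outcome x y (agree a p) ∷ z ∷ [])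
                       (column y p)) _ _}
        refl refl
        (skip-run skip₃ b refl
          (drop-applyUpTo-all (λ i → outcome x y (agree (suc a + i) p)) b) λ _ →
          runTo-tidy found 40 (ambiguous-tail (x a) (y a) x<y (x p) (y p))
            (ambiguous-run x y a x<y m (suc b) (suc p) q
              (trans (cong suc p≡) (sym (+-suc a (suc b))))
              (trans q≡ (+-suc p m)))))

-- x ≤ y lexicographically on m digits from p; the last index is what has to be output after the
-- digits of x.
data LexLe (x y : ℕ → Fin 3) (q : ℕ) : (p m : ℕ) → List ℕ → Set where
  equal : ∀ {p} → LexLe x y q p 0 []
  here  : ∀ {p m} → x p Fin.< y p → q ≡ p + suc m → LexLe x y q p (suc m) (from y 0 q)
  there : ∀ {p m os} → x p ≡ y p → LexLe x y q (suc p) m os → LexLe x y q p (suc m) os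

LexLe-refl : ∀ x q p m → LexLe x x q p m []
LexLe-refl x q p zero    = equal
LexLe-refl x q p (suc m) = there refl (LexLe-refl x q (suc p) m)

-- Distinct items can be named so that the one with the smaller digit at their first difference is
-- `x`, which is the order in which the program outputs them.
LexLe-connex : ∀ x y q p m → q ≡ p + m → from x p m ≢ from y p m →
  LexLe x y q p m (from y 0 q) ⊎ LexLe y x q p m (from x 0 q)
LexLe-connex x y q p zero    q≡ x≢y = contradiction refl x≢y
LexLe-connex x y q p (suc m) q≡ x≢y with Fin.<-cmp (x p) (y p)
... | tri< x<y _ _ = inj₁ (here x<y q≡)
... | tri> _ _ y<x = inj₂ (here y<x q≡)
... | tri≈ _ x≡y _ = Sum.map (there x≡y) (there (sym x≡y))
  (LexLe-connex x y q (suc p) m (trans q≡ (+-suc p m)) (x≢y ∘ cong₂ _∷_ (cong toℕ x≡y)))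

unambiguous-end-cost : ∀ p → 1 + (p * 4 + (1 + 20)) + (p * 6 + 38) ≡ p * 10 + 60
unambiguous-end-cost = solve-∀

unambiguous-cost : ∀ p c → 1 + (p * 4 + (1 + (40 + c))) + 8 ≡ p * 4 + 50 + c
unambiguous-cost = solve-∀

-- The constructors of `LexLe` follow the control flow: `there` returns to `top`, `here` passes on
-- to `found`, and `equal` exits with the array unwritten.
unambiguous-run : ∀ {x y q p m extra} → LexLe x y q p m extra → ∀ {e z os} →
  program ⊢ state top (cells (8 + p ∷ p ∷ 0 ∷ 0 ∷ 0 ∷ 0 ∷ e ∷ z ∷ []) (column y p))
                  (outcomes x y p m) os
    ⇓ os ++ (from x p m ++ extra) within cost p m
unambiguous-run {p = p} equal {os = os} rewrite ++-identityʳ os =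
  within-mono (≤-slack (p * 6 + 38) (unambiguous-end-cost p))
    (skip-run skip₁ p refl (drop-[] p) λ _ →
      runTo-tidy exit 20
        {s′ = state exit (cells (8 + p ∷ p ∷ 0 ∷ 0 ∷ 0 ∷ 0 ∷ _ ∷ 0 ∷ []) (column _ p)) [] os}
        refl exited)
unambiguous-run {x} {y} {q} {p} {suc m} (here x<y q≡) {os = os}
  rewrite sym (++-assoc os [ toℕ (x p) ] (from x (suc p) m ++ from y 0 q)) =
  within-mono (≤-slack 8 (unambiguous-cost p (cost (suc p) m)))
    (skip-run skip₁ p refl (drop-agree x y p m) λ _ →
      unambiguous-tail-< (x p) (y p) x<y
        (ambiguous-run x y p x<y m 0 (suc p) q (sym (+-comm p 1)) (trans q≡ (+-suc p m))))
unambiguous-run {x} {y} {q} {p} {suc m} {extra} (there x≡y l) {os = os}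
  rewrite sym (++-assoc os [ toℕ (x p) ] (from x (suc p) m ++ extra)) =
  within-mono (≤-slack 8 (unambiguous-cost p (cost (suc p) m)))
    (skip-run skip₁ p refl (drop-agree x y p m) λ _ →
      unambiguous-tail-≡ (x p) (y p) x≡y (unambiguous-run l))

program-run : ∀ {x y q extra} t → LexLe x y q 0 q extra →
  program ⊢ start (t ∷ outcomes x y 0 q) ⇓ from x 0 q ++ extra within (3 + cost 0 q)
program-run t l = runTo-tidy top 3 refl (unambiguous-run l)

-- Block 0 has no agreement tests, so its three negative digit tests come first and the program
-- exits at once.
program-run-∅ : ∀ t q .{{_ : NonZero q}} →
  program ⊢ start (t ∷ map (λ _ → 0) (blocks 0 q)) ⇓ [] within 20
program-run-∅ t (suc q) = runTo-tidy exit 20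
  {s′ = state exit (cells (8 ∷ 0 ∷ 0 ∷ 0 ∷ 0 ∷ 0 ∷ 0 ∷ 0 ∷ []) (λ _ → 0)) _ []} refl exited

-- The number of tests and bounds on the cost

20≤cost : ∀ p m → 20 ≤ cost p m
20≤cost p zero    = ≤-trans (m≤n+m 20 40) (m≤n+m 60 (p * 10))
20≤cost p (suc m) = ≤-trans (20≤cost (suc p) m) (m≤n+m _ (p * 4 + 50))

-- Block r has r + 3 tests, so this sums an arithmetic progression over the `m` blocks from `p` on,
-- doubled to avoid division.
length-blocks : ∀ p m → length (blocks p m) * 2 ≡ m * (p * 2 + m + 5)
length-blocks p zero    = refl
length-blocks p (suc m)
  rewrite length-++ (applyUpTo (λ j → agree j p) p)
            {hasDigit p 0F ∷ hasDigit p 1F ∷ hasDigit p 2F ∷ blocks (suc p) m}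
        | length-applyUpTo (λ j → agree j p) p
        = trans (split p (length (blocks (suc p) m)))
            (trans (cong (p * 2 + 6 +_) (length-blocks (suc p) m)) (merge p m))
  where
  split : ∀ p l → (p + suc (suc (suc l))) * 2 ≡ p * 2 + 6 + l * 2
  split = solve-∀
  merge : ∀ p m → p * 2 + 6 + m * (suc p * 2 + m + 5) ≡ suc m * (p * 2 + suc m + 5)
  merge = solve-∀

size : ℕ → ℕ
size q = (q ^ 2 + 5 * q) / 2

length-tests : ∀ q → length (blocks 0 q) ≡ size q
length-tests q = trans (sym (m*n/n≡m (length (blocks 0 q)) 2))
  (cong (_/ 2) (trans (length-blocks 0 q) (square q)))
  where
  square : ∀ q → q * (q + 5) ≡ q * (q * 1) + 5 * q
  square = solve-∀

-- A block of p + 3 tests is charged 4p + 50 steps, and 17 is the least factor with 17 * 3 at least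
-- 50.
cost-bound : ∀ p m → cost p m ≤ length (blocks p m) * 17 + ((p + m) * 10 + 60)
cost-bound p zero rewrite +-identityʳ p = ≤-refl
cost-bound p (suc m)
  rewrite length-++ (applyUpTo (λ j → agree j p) p)
            {hasDigit p 0F ∷ hasDigit p 1F ∷ hasDigit p 2F ∷ blocks (suc p) m}
        | length-applyUpTo (λ j → agree j p) p
        = ≤-trans (+-monoʳ-≤ (p * 4 + 50) (cost-bound (suc p) m))
                  (≤-slack (p * 13 + 1) (rows p (length (blocks (suc p) m)) m))
  where
  rows : ∀ p l m → p * 4 + 50 + (l * 17 + ((suc p + m) * 10 + 60)) + (p * 13 + 1) ≡
                   (p + suc (suc (suc l))) * 17 + ((p + suc m) * 10 + 60)
  rows = solve-∀

-- Items as digit sequences, and the matrix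

extend : ∀ {q} → (Fin q → Fin 3) → ℕ → Fin 3
extend {zero}  f _       = 0F
extend {suc q} f zero    = f zero
extend {suc q} f (suc j) = extend (f ∘ suc) j

from-suc : ∀ x p m → from x (suc p) m ≡ from (x ∘ suc) p m
from-suc x p zero    = refl
from-suc x p (suc m) = cong (_ ∷_) (from-suc x (suc p) m)

tabulate-from : ∀ {q} (f : Fin q → Fin 3) → List.tabulate (λ i → toℕ (f i)) ≡ from (extend f) 0 q
tabulate-from {zero}  f = refl
tabulate-from {suc q} f =
  cong (toℕ (f 0F) ∷_) (trans (tabulate-from (f ∘ suc)) (sym (from-suc (extend f) 0 q)))

-- A sequence on all of ℕ, so that tests need no bounds on positions. The padding by `extend` is
-- never looked at, as `blocks 0 q` concerns positions below `q` only.
item : ∀ q → Fin (3 ^ q) → ℕ → Fin 3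
item q i = extend (Fin.finToFun {3} {q} i)

digits-from : ∀ q i → digits 3 q i ≡ from (item q i) 0 q
digits-from q i = tabulate-from (Fin.finToFun {3} {q} i)

tabulate-injective : ∀ {A : Set} {n} {f g : Fin n → A} →
  List.tabulate f ≡ List.tabulate g → f ≗ g
tabulate-injective {n = suc n} eq zero    = ∷-injectiveˡ eq
tabulate-injective {n = suc n} eq (suc i) = tabulate-injective (∷-injectiveʳ eq) i

funToFin-cong : ∀ {m n} {f g : Fin m → Fin n} → f ≗ g → Fin.funToFin f ≡ Fin.funToFin g
funToFin-cong {zero}  eq = refl
funToFin-cong {suc m} eq = cong₂ Fin.combine (eq zero) (funToFin-cong (eq ∘ suc))

digits-injective : ∀ b q {i j} → digits b q i ≡ digits b q j → i ≡ j
digits-injective b q {i} {j} eq =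
  trans (sym (Fin.funToFin-finToFin {q} {b} i))
    (trans (funToFin-cong (Fin.toℕ-injective ∘ tabulate-injective eq))
           (Fin.funToFin-finToFin {q} {b} j))

matrix : ∀ q → BooleanMatrix (size q) (3 ^ q)
matrix q r i = List.lookup (blocks 0 q) (Fin.cast (sym (length-tests q)) r) (item q i)

toList-tabulate-lookup : ∀ {A B : Set} (f : A → B) xs {n} .(eq : n ≡ length xs) →
  toList (tabulate λ r → f (List.lookup xs (Fin.cast eq r))) ≡ map f xs
toList-tabulate-lookup f []       {zero}  eq = refl
toList-tabulate-lookup f (x ∷ xs) {suc n} eq =
  cong (f x ∷_) (toList-tabulate-lookup f xs (cong pred eq))

-- Test outcomes of sets of at most two items

positive? : ∀ {n} (D : Subset n) (f : Fin n → Bool) → Dec (∃[ i ] (i ∈ˢ D × f i ≡ true))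
positive? D f = Fin.any? λ i → (i ∈? D) ×-dec (f i Bool.≟ true)

-- `i` and `j` may be equal, so this serves one defective item as well as two.
positive-pair : ∀ {n} {D : Subset n} {i j} → i ∈ˢ D → j ∈ˢ D →
  (∀ {k} → k ∈ˢ D → k ≡ i ⊎ k ≡ j) → ∀ f → does (positive? D f) ≡ f i ∨ f j
positive-pair {D = D} {i} {j} i∈D j∈D cover f with f i in fi | f j in fj
... | true  | _     = dec-true (positive? D f) (i , i∈D , fi)
... | false | true  = dec-true (positive? D f) (j , j∈D , fj)
... | false | false = dec-false (positive? D f) λ (_ , k∈D , fk) →
  [ clash fk fi , clash fk fj ]′ (cover k∈D)
  where
  clash : ∀ {k l} → f k ≡ true → f l ≡ false → k ≢ l
  clash fk fl refl = contradiction (trans (sym fk) fl) λ ()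

positive-∅ : ∀ {n} {D : Subset n} → Empty D → ∀ f → does (positive? D f) ≡ false
positive-∅ {D = D} empty f = dec-false (positive? D f) λ (k , k∈D , _) → empty (k , k∈D)

encodeOutcomes-matrix : ∀ q D {b : Test → Bool} →
  (∀ f → does (positive? D (f ∘ item q)) ≡ b f) →
  encodeOutcomes (testOutcomes (matrix q) D) ≡ size q ∷ map (bit ∘ b) (blocks 0 q)
encodeOutcomes-matrix q D {b} eq = cong (size q ∷_)
  (trans (cong (map bit)
           (trans (toList-tabulate-lookup (λ f → does (positive? D (f ∘ item q))) (blocks 0 q) _)
                  (map-cong eq (blocks 0 q))))
         (sym (map-∘ (blocks 0 q))))

data Small {n} (D : Subset n) : Set where
  none : Empty D → Small D
  one  : ∀ i → i ∈ˢ D → (∀ {k} → k ∈ˢ D → k ≡ i) → Small D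
  two  : ∀ i j → i ≢ j → i ∈ˢ D → j ∈ˢ D → (∀ {k} → k ∈ˢ D → k ≡ i ⊎ k ≡ j) → Small D

small : ∀ {n} (D : Subset n) → ∣ D ∣ ≤ 2 → Small D
small D ∣D∣≤2 with Fin.any? (_∈? D)
... | no empty = none empty
... | yes (i , i∈D) with Fin.any? (λ j → (j ∈? D) ×-dec ¬? (j Fin.≟ i))
...   | no ¬other = one i i∈D λ {k} k∈D →
  decidable-stable (k Fin.≟ i) λ k≢i → ¬other (k , k∈D , k≢i)
...   | yes (j , j∈D , j≢i) = two i j (j≢i ∘ sym) i∈D j∈D cover
  where
  cover : ∀ {k} → k ∈ˢ D → k ≡ i ⊎ k ≡ j
  cover {k} k∈D with k Fin.≟ i | k Fin.≟ j
  ... | yes k≡i | _       = inj₁ k≡i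
  ... | no _    | yes k≡j = inj₂ k≡j
  -- Removing `i`, then `j`, then `k` lowers the cardinality three times, so it was at least 3.
  ... | no k≢i  | no k≢j  = contradiction ∣D∣≤2 (<⇒≱
    (≤-trans (s≤s (≤-trans (s≤s (≤-trans (s≤s z≤n)
      (x∈p⇒∣p-x∣<∣p∣ (x∈p∧x≢y⇒x∈p-y (x∈p∧x≢y⇒x∈p-y k∈D k≢i) k≢j))))
      (x∈p⇒∣p-x∣<∣p∣ (x∈p∧x≢y⇒x∈p-y j∈D j≢i))))
      (x∈p⇒∣p-x∣<∣p∣ i∈D)))

-- Analysis implies separability

⇓-functional : ∀ {os os′ k k′} → P ⊢ s ⇓ os after k → P ⊢ s ⇓ os′ after k′ → os ≡ os′
⇓-functional (halt _)   (halt _)    = refl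
⇓-functional (halt f)   (step f′ _) = contradiction (trans (sym f) f′) λ ()
⇓-functional (step f _) (halt f′)   = contradiction (trans (sym f) f′) λ ()
⇓-functional (step f d) (step f′ d′) with refl ← trans (sym f) f′ = ⇓-functional d d′

++-injective : ∀ {A : Set} (xs ys : List A) {xs′ ys′} → length xs ≡ length ys →
  xs ++ xs′ ≡ ys ++ ys′ → xs ≡ ys × xs′ ≡ ys′
++-injective []       []       _  eq = refl , eq
++-injective (x ∷ xs) (y ∷ ys) ℓ eq with ++-injective xs ys (suc-injective ℓ) (∷-injectiveʳ eq)
... | xs≡ys , xs′≡ys′ = cong₂ _∷_ (∷-injectiveˡ eq) xs≡ys , xs′≡ys′

-- All pieces have the same length, so the concatenation can be cut at known places; that length is
-- positive, so the number of pieces is determined too.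
concatMap-injective : ∀ {A B : Set} (f : A → List B) n → (∀ a → length (f a) ≡ suc n) →
  (∀ {a b} → f a ≡ f b → a ≡ b) → ∀ xs ys → concatMap f xs ≡ concatMap f ys → xs ≡ ys
concatMap-injective f n ℓ inj []       []       _  = refl
concatMap-injective f n ℓ inj []       (y ∷ ys) eq with f y | ℓ y
... | _ ∷ _ | _ = contradiction eq λ ()
concatMap-injective f n ℓ inj (x ∷ xs) []       eq with f x | ℓ x
... | _ ∷ _ | _ = contradiction eq λ ()
concatMap-injective f n ℓ inj (x ∷ xs) (y ∷ ys) eq
  with ++-injective (f x) (f y) (trans (ℓ x) (sym (ℓ y))) eq
... | fx≡fy , eq′ = cong₂ _∷_ (inj fx≡fy) (concatMap-injective f n ℓ inj xs ys eq′)

OutputEncodes-injective : ∀ b q .{{_ : NonZero q}} {os} {D E : Subset (b ^ q)} →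
  OutputEncodes b q os D → OutputEncodes b q os E → D ≡ E
OutputEncodes-injective b (suc q) (L , (_ , L⇔D) , refl) (L′ , (_ , L′⇔E) , eq)
  with refl ← concatMap-injective (digits b (suc q)) q
                (λ i → length-tabulate (λ j → toℕ (Fin.finToFun {b} {suc q} i j)))
                (digits-injective b (suc q)) L L′ eq =
  ⊆-antisym (λ {i} i∈D → Equivalence.to (L′⇔E i) (Equivalence.from (L⇔D i) i∈D))
            (λ {i} i∈E → Equivalence.to (L⇔D i) (Equivalence.from (L′⇔E i) i∈E))

does-∈? : ∀ {n} (i : Fin n) S → does (i ∈? S) ≡ lookup S i
does-∈? zero    (true  ∷ S) = refl
does-∈? zero    (false ∷ S) = refl
does-∈? (suc i) (_     ∷ S) = does-∈? i S

does-any? : ∀ {n} {A : Fin n → Set} (A? : ∀ i → Dec (A i)) →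
  does (Fin.any? A?) ≡ foldr _∨_ false (λ i → does (A? i))
does-any? {zero}  A? = refl
does-any? {suc n} A? = cong (does (A? zero) ∨_) (does-any? (A? ∘ suc))

foldr-∨-cong : ∀ {n} {f g : Fin n → Bool} → f ≗ g → foldr _∨_ false f ≡ foldr _∨_ false g
foldr-∨-cong {zero}  eq = refl
foldr-∨-cong {suc n} eq = cong₂ _∨_ (eq zero) (foldr-∨-cong (eq ∘ suc))

does-≟true : ∀ b → does (b Bool.≟ true) ≡ b
does-≟true true  = refl
does-≟true false = refl

-- Links separability, which speaks of Boolean sums, to the input of the analysis.
testOutcomes≡booleanSum : ∀ {t n} (M : BooleanMatrix t n) S → testOutcomes M S ≡ booleanSum M S
testOutcomes≡booleanSum M S = tabulate-cong λ r →
  trans (does-any? λ i → (i ∈? S) ×-dec (M r i Bool.≟ true))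
        (foldr-∨-cong λ i → cong₂ _∧_ (does-∈? i S) (does-≟true (M r i)))

analysable⇒separable : ∀ {d b t M} → HasTimeOptimalAnalysis d b t M →
  ∀ q .{{_ : NonZero q}} → Separable d (M q)
analysable⇒separable {b = b} {M = M} (P , _ , analyse) q S T ∣S∣≤d ∣T∣≤d eq
  with analyse q S ∣S∣≤d | analyse q T ∣T∣≤d
... | _ , _ , runS , _ , S-out | _ , _ , runT , _ , T-out =
  OutputEncodes-injective b q S-out
    (subst (λ os → OutputEncodes b q os T) (sym same-output) T-out)
  where
  same-outcomes : testOutcomes (M q) S ≡ testOutcomes (M q) T
  same-outcomes = trans (testOutcomes≡booleanSum (M q) S)
                        (trans eq (sym (testOutcomes≡booleanSum (M q) T)))
  same-output = ⇓-functional
    (subst (λ v → P ⊢ start (encodeOutcomes v) ⇓ _ after _) same-outcomes runS) runT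

-- The linear time bound and the analysis of all cases

q≤size : ∀ q → q ≤ size q
q≤size q rewrite sym (length-tests q) = *-cancelʳ-≤ q (length (blocks 0 q)) 2
  (subst (q * 2 ≤_) (sym (length-blocks 0 q)) (*-monoʳ-≤ q (≤-trans (m≤n+m 2 3) (m≤n+m 5 q))))

-- Both 1 and `q` are at most `size q`, so the constant and linear terms are absorbed: 90 = 17 + 10
-- + 63.
total-cost : ∀ q .{{_ : NonZero q}} → 3 + cost 0 q ≤ 90 * size q
total-cost q = begin
  3 + cost 0 q
    ≤⟨ +-monoʳ-≤ 3 (cost-bound 0 q) ⟩
  3 + (length (blocks 0 q) * 17 + (q * 10 + 60))
    ≡⟨ cong (λ l → 3 + (l * 17 + (q * 10 + 60))) (length-tests q) ⟩
  3 + (size q * 17 + (q * 10 + 60))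
    ≡⟨ gather (size q) q ⟩
  size q * 17 + q * 10 + 1 * 63
    ≤⟨ +-mono-≤ (+-monoʳ-≤ (size q * 17) (*-monoˡ-≤ 10 (q≤size q)))
                (*-monoˡ-≤ 63 (≤-trans (>-nonZero⁻¹ q) (q≤size q))) ⟩
  size q * 17 + size q * 10 + size q * 63
    ≡⟨ sum (size q) ⟩
  90 * size q ∎
  where
  open ≤-Reasoning
  gather : ∀ t q → 3 + (t * 17 + (q * 10 + 60)) ≡ t * 17 + q * 10 + 1 * 63
  gather = solve-∀
  sum : ∀ t → t * 17 + t * 10 + t * 63 ≡ 90 * t
  sum = solve-∀

hasTimeOptimalAnalysis : HasTimeOptimalAnalysis 2 3 size (λ q → matrix q)
hasTimeOptimalAnalysis = program , 90 , analyse
  where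
  module _ (q : ℕ) .{{_ : NonZero q}} (D : Subset (3 ^ q)) where

    Analysed : List ℕ → Set
    Analysed os = ∃[ k ]
      ( program ⊢ start (encodeOutcomes (testOutcomes (matrix q) D)) ⇓ os after k
      × k ≤ 90 * size q
      × OutputEncodes 3 q os D )

    conclude : ∀ {b os} → (∀ f → does (positive? D (f ∘ item q)) ≡ b f) →
      program ⊢ start (size q ∷ map (bit ∘ b) (blocks 0 q)) ⇓ os within (3 + cost 0 q) →
      OutputEncodes 3 q os D → ∃[ os ] Analysed os
    conclude {os = os} b≗ (k , k≤ , d) out = os , k ,
      subst (λ is → program ⊢ start is ⇓ os after k) (sym (encodeOutcomes-matrix q D b≗)) d ,
      ≤-trans k≤ (total-cost q) , out

  listsOne : ∀ {n} {D : Subset n} {i} → i ∈ˢ D → (∀ {k} → k ∈ˢ D → k ≡ i) → (i ∷ []) Lists D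
  listsOne i∈D cover = [] ∷ [] , λ k → mk⇔ (λ { (here refl) → i∈D }) (here ∘ cover)

  listsTwo : ∀ {n} {D : Subset n} {i j} → i ≢ j → i ∈ˢ D → j ∈ˢ D →
    (∀ {k} → k ∈ˢ D → k ≡ i ⊎ k ≡ j) → (i ∷ j ∷ []) Lists D
  listsTwo i≢j i∈D j∈D cover = (i≢j ∷ []) ∷ [] ∷ [] , λ k →
    mk⇔ (λ { (here refl) → i∈D ; (there (here refl)) → j∈D })
        ([ here , (λ k≡j → there (here k≡j)) ]′ ∘ cover)

  encodesOne : ∀ q i → from (item q i) 0 q ++ [] ≡ concatMap (digits 3 q) (i ∷ [])
  encodesOne q i = cong (_++ []) (sym (digits-from q i))

  encodesTwo : ∀ q i j →
    from (item q i) 0 q ++ from (item q j) 0 q ≡ concatMap (digits 3 q) (i ∷ j ∷ [])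
  encodesTwo q i j = cong₂ _++_ (sym (digits-from q i))
    (trans (sym (++-identityʳ _)) (encodesOne q j))

  analyse : ∀ q .{{_ : NonZero q}} (D : Subset (3 ^ q)) → ∣ D ∣ ≤ 2 → ∃[ os ] Analysed q D os
  analyse q D ∣D∣≤2 with small D ∣D∣≤2
  ... | none empty = conclude q D (λ f → positive-∅ empty (f ∘ item q))
    (within-mono (m≤n⇒m≤o+n 3 (20≤cost 0 q)) (program-run-∅ (size q) q))
    ([] , ([] , λ k → mk⇔ (λ ()) (λ k∈D → contradiction (k , k∈D) empty)) , refl)
  -- A single item is analysed as a pair of equal ones, for which no position is ambiguous.
  ... | one i i∈D cover = conclude q D (λ f → positive-pair i∈D i∈D (inj₁ ∘ cover) (f ∘ item q))
    (program-run (size q) (LexLe-refl (item q i) q 0 q))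
    (i ∷ [] , listsOne i∈D cover , encodesOne q i)
  ... | two i j i≢j i∈D j∈D cover
    with LexLe-connex (item q i) (item q j) q 0 q refl
           (λ eq → i≢j (digits-injective 3 q
             (trans (digits-from q i) (trans eq (sym (digits-from q j))))))
  ...   | inj₁ i<j = conclude q D (λ f → positive-pair i∈D j∈D cover (f ∘ item q))
    (program-run (size q) i<j)
    (i ∷ j ∷ [] , listsTwo i≢j i∈D j∈D cover , encodesTwo q i j)
  ...   | inj₂ j<i = conclude q D (λ f → positive-pair j∈D i∈D (Sum.swap ∘ cover) (f ∘ item q))
    (program-run (size q) j<i)
    (j ∷ i ∷ [] , listsTwo (i≢j ∘ sym) j∈D i∈D (Sum.swap ∘ cover) , encodesTwo q j i)

theorem3 : Σ ((q : ℕ) → .{{_ : NonZero q}} → BooleanMatrix ((q ^ 2 + 5 * q) / 2) (3 ^ q)) λ M →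
    ((q : ℕ) → .{{_ : NonZero q}} → Separable 2 (M q)) ×
    HasTimeOptimalAnalysis 2 3 (λ q → (q ^ 2 + 5 * q) / 2) M
theorem3 = (λ q → matrix q) , analysable⇒separable hasTimeOptimalAnalysis , hasTimeOptimalAnalysis
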